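{- Let $m$ be a natural number with prime factorization $m=\prod_{i=1}^w p_i^{b_i}$, where $p_1,\dots,p_w$ are distinct primes and $b_i\geq 1$. Then $$m^2\leq \ell(m)\leq m^{w+1}.$$
   Context: For a natural number $m\geq 1$, $\ell(m)$ denotes the minimal period modulo $m$ of the sequence $n\mapsto\binom{n}{m}$, that is, the least non-zero natural number $\ell$ such that $\binom{n+\ell}{m}\equiv\binom{n}{m}\pmod m$ for all positive integers $n$, with the convention $\binom{n}{m}=0$ if $0\leq n<m$. The paper recalls as known that, for $m=\prod_{i=1}^w p_i^{b_i}$ as in the claim, $\ell(m)=\prod_{i=1}^w p_i^{\lfloor\log_{p_i}m\rfloor+b_i}=m\prod_{i=1}^w p_i^{\lfloor\log_{p_i}m\rfloor}$. -}

module Defs where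

open import Data.Nat
open import Data.Nat.Properties
open import Data.Nat.Combinatorics
open import Data.Nat.DivMod
open import Data.Nat.Divisibility
open import Data.Nat.Induction using (<-rec)
open import Data.Nat.Tactic.RingSolver using (solve-∀)
open import Data.Product using (Σ; _×_; _,_; proj₁; proj₂)
open import Data.Fin using (Fin)
open import Data.List using (tabulate)
open import Data.Nat.ListAction using (product)
open import Relation.Nullary using (yes; no)
open import Relation.Nullary.Decidable using (map′; _×-dec_; _→-dec_)
open import Relation.Unary using (Pred; Decidable)
open import Relation.Binary.PropositionalEquality

∏ : ∀ {w} → (Fin w → ℕ) → ℕ
∏ f = product (tabulate f)

module _ (m : ℕ) .{{_ : NonZero m}} where

  infix 4 _≡ₘ_
  _≡ₘ_ : ℕ → ℕ → Set
  a ≡ₘ b = a % m ≡ b % m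

  IsPeriod : ℕ → Set
  IsPeriod k = 0 < k × (∀ n → 0 < n → (n + k) C m ≡ₘ n C m)

  IsLeastPeriod : ℕ → Set
  IsLeastPeriod k = IsPeriod k × (∀ j → IsPeriod j → k ≤ j)

-- The rest shows that a least period exists, so that ℓ can be defined as a
-- function: m * m ! is a period, and, one period being known, whether k is a
-- period is decided by finitely many congruences.

least : ∀ {p} {P : Pred ℕ p} → Decidable P → ∀ k → P k →
        Σ ℕ λ i → P i × (∀ j → P j → i ≤ j)
least {P = P} P? = <-rec _ step
  where
  step : ∀ k → (∀ {j} → j < k → P j → Σ ℕ λ i → P i × (∀ j → P j → i ≤ j)) →
         P k → Σ ℕ λ i → P i × (∀ j → P j → i ≤ j)
  step k rec pk with anyUpTo? P? k
  ... | yes (j , j<k , pj) = rec j<k pj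
  ... | no none = k , pk , λ j pj → ≮⇒≥ λ j<k → none (j , j<k , pj)

absorption : ∀ n k → suc k * (suc n C suc k) ≡ suc n * (n C k)
absorption n zero = begin
  1 * (suc n C 1)  ≡⟨ *-identityˡ _ ⟩
  suc n C 1        ≡⟨ nC1≡n (suc n) ⟩
  suc n            ≡⟨ *-identityʳ (suc n) ⟨
  suc n * 1        ≡⟨ cong (suc n *_) (nCk≡1 n) ⟨
  suc n * (n C 0)  ∎
  where
  open ≡-Reasoning
  nCk≡1 : ∀ n → n C 0 ≡ 1
  nCk≡1 n = trans (nCk≡nC[n∸k] {0} {n} z≤n) (nCn≡1 n)
absorption zero (suc k) = begin
  suc (suc k) * (1 C suc (suc k))  ≡⟨ cong (suc (suc k) *_) (k>n⇒nCk≡0 {1} {suc (suc k)} (s≤s (s≤s z≤n))) ⟩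
  suc (suc k) * 0                  ≡⟨ *-zeroʳ (suc (suc k)) ⟩
  0                                ≡⟨ cong (1 *_) (k>n⇒nCk≡0 {0} {suc k} (s≤s z≤n)) ⟨
  1 * (0 C suc k)                  ∎
  where open ≡-Reasoning
absorption (suc n) (suc k) = begin
  suc (suc k) * (suc (suc n) C suc (suc k))
    ≡⟨ cong (suc (suc k) *_) (nCk+nC[k+1]≡[n+1]C[k+1] (suc n) (suc k)) ⟨
  suc (suc k) * (c + suc n C suc (suc k))
    ≡⟨ *-distribˡ-+ (suc (suc k)) c _ ⟩
  (c + suc k * c) + suc (suc k) * (suc n C suc (suc k))
    ≡⟨ cong₂ (λ x y → (c + x) + y) (absorption n k) (absorption n (suc k)) ⟩
  (c + suc n * (n C k)) + suc n * (n C suc k)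
    ≡⟨ +-assoc c _ _ ⟩
  c + (suc n * (n C k) + suc n * (n C suc k))
    ≡⟨ cong (c +_) (*-distribˡ-+ (suc n) (n C k) _) ⟨
  c + suc n * (n C k + n C suc k)
    ≡⟨ cong (λ x → c + suc n * x) (nCk+nC[k+1]≡[n+1]C[k+1] n k) ⟩
  suc (suc n) * c ∎
  where
  open ≡-Reasoning
  c = suc n C suc k

module _ (m : ℕ) .{{_ : NonZero m}} where

  period₀ : ℕ
  period₀ = m * m !

  period₀>0 : 0 < period₀
  period₀>0 = >-nonZero⁻¹ period₀
    where instance
    _ = m !≢0
    _ = m*n≢0 m (m !)

  m∣period₀C : ∀ k → suc k ≤ m → m ∣ period₀ C suc k
  m∣period₀C k k<m = *-cancelˡ-∣ (suc k) (subst (suc k * m ∣_) (sym absorb) (∣m⇒∣m*n _ k*m∣))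
    where
    L = pred period₀
    sucL : suc L ≡ period₀
    sucL = suc-pred period₀ {{>-nonZero period₀>0}}
    absorb : suc k * (period₀ C suc k) ≡ period₀ * (L C k)
    absorb = subst (λ x → suc k * (x C suc k) ≡ x * (L C k)) sucL (absorption L k)
    k*m∣ : suc k * m ∣ period₀
    k*m∣ = subst (_∣ period₀) (*-comm m (suc k))
             (*-monoʳ-∣ m (∣-trans (m∣m*n (k !)) (m≤n⇒m!∣n! k<m)))

  period₀-≡ : ∀ n k → k ≤ m → _≡ₘ_ m ((n + period₀) C k) (n C k)
  period₀-≡ n zero _ = cong (_% m) refl
  period₀-≡ zero (suc k) k<m = begin
    (period₀ C suc k) % m  ≡⟨ n∣m⇒m%n≡0 _ m (m∣period₀C k k<m) ⟩
    0                      ≡⟨ n∣m⇒m%n≡0 0 m (m ∣0) ⟨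
    0 % m                  ∎
    where open ≡-Reasoning
  period₀-≡ (suc n) (suc k) k<m = begin
    (suc N C suc k) % m                        ≡⟨ cong (_% m) (nCk+nC[k+1]≡[n+1]C[k+1] N k) ⟨
    (N C k + N C suc k) % m                    ≡⟨ %-distribˡ-+ (N C k) (N C suc k) m ⟩
    ((N C k) % m + (N C suc k) % m) % m        ≡⟨ cong₂ (λ x y → (x + y) % m) (period₀-≡ n k (<⇒≤ k<m)) (period₀-≡ n (suc k) k<m) ⟩
    ((n C k) % m + (n C suc k) % m) % m        ≡⟨ %-distribˡ-+ (n C k) (n C suc k) m ⟨
    (n C k + n C suc k) % m                    ≡⟨ cong (_% m) (nCk+nC[k+1]≡[n+1]C[k+1] n k) ⟩
    (suc n C suc k) % m                        ∎
    where
    open ≡-Reasoning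
    N = n + period₀

  period₀-isPeriod : IsPeriod m period₀
  period₀-isPeriod = period₀>0 , λ n _ → period₀-≡ n m ≤-refl

  isPeriod? : Decidable (IsPeriod m)
  isPeriod? k = (0 <? k) ×-dec map′ extend (λ f {n} _ → f n)
                  (allUpTo? (λ n → (0 <? n) →-dec (((n + k) C m) % m ≟ (n C m) % m)) (suc period₀))
    where
    Q : ℕ → Set
    Q n = 0 < n → _≡ₘ_ m ((n + k) C m) (n C m)
    extend : (∀ {n} → n < suc period₀ → Q n) → ∀ n → Q n
    extend f = <-rec Q step
      where
      step : ∀ n → (∀ {i} → i < n → Q i) → Q n
      step n rec n>0 with n <? suc period₀
      ... | yes n≤P = f n≤P n>0
      ... | no n≰P = begin
        ((n + k) C m) % m            ≡⟨ cong (λ x → (x C m) % m) shift ⟨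
        ((d + k + period₀) C m) % m  ≡⟨ period₀-≡ (d + k) m ≤-refl ⟩
        ((d + k) C m) % m            ≡⟨ rec d<n (m<n⇒0<n∸m P<n) ⟩
        (d C m) % m                  ≡⟨ period₀-≡ d m ≤-refl ⟨
        ((d + period₀) C m) % m      ≡⟨ cong (λ x → (x C m) % m) (m∸n+n≡m (<⇒≤ P<n)) ⟩
        (n C m) % m                  ∎
        where
        open ≡-Reasoning
        P<n : period₀ < n
        P<n = ≮⇒≥ n≰P
        d = n ∸ period₀
        d<n : d < n
        d<n = ∸-monoʳ-< period₀>0 (<⇒≤ P<n)
        swap : ∀ a b c → a + b + c ≡ a + c + b
        swap = solve-∀
        shift : d + k + period₀ ≡ n + k
        shift = trans (swap d k period₀) (cong (_+ k) (m∸n+n≡m (<⇒≤ P<n)))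

  leastPeriod : Σ ℕ (IsLeastPeriod m)
  leastPeriod = least isPeriod? period₀ period₀-isPeriod

  ℓ : ℕ
  ℓ = proj₁ leastPeriod

  ℓ-isLeastPeriod : IsLeastPeriod m ℓ
  ℓ-isLeastPeriod = proj₂ leastPeriod

{-# OPTIONS --safe #-}

-- If T is a period, reading Pascal's rule downwards shows that T is a period of
-- every n ↦ n C k with k ≤ m; at n = 0 this says that m ∣ T C k for 1 ≤ k ≤ m.
-- Hence consecutive entries of row T - 1 sum to 0 modulo m up to column m, so all
-- of them are coprime to m, and m * (T C m) = T * ((T - 1) C (m - 1)) gives m² ∣ T.
--
-- Conversely T is a period as soon as m ∣ T C k for 1 ≤ k ≤ m.  If q i is the
-- largest power of p i with q i ≤ m, this holds for T = m * ∏ q, because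
-- k * (T C k) = T * ((T - 1) C (k - 1)) and the p i-part of k divides q i.  Each
-- q i is at most m, so T ≤ m ^ (w + 1).

module Submission where

open import Defs
open import Data.Nat using (ℕ; _^_; _≤_; NonZero; _+_)
open import Data.Nat.Primality using (Prime)
open import Data.Fin using (Fin)
open import Data.Product using (_×_)
open import Function.Definitions using (Injective)
open import Relation.Binary.PropositionalEquality using (_≡_)

open import Data.Fin using (zero; suc)
open import Data.Fin.Properties using (0≢1+n; suc-injective)
open import Data.Nat
  using (zero; suc; _*_; _∸_; _<_; _≤?_; pred; z≤n; z<s; >-nonZero; >-nonZero⁻¹; nonTrivial⇒n>1)
open import Data.Nat.Combinatorics using (_C_; nCn≡1; nCk≡nC[n∸k]; nCk+nC[k+1]≡[n+1]C[k+1])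
open import Data.Nat.Coprimality using (Coprime; coprime-divisor; 1-coprimeTo) renaming (sym to coprime-sym)
open import Data.Nat.Divisibility
open import Data.Nat.DivMod
open import Data.Nat.Induction using (<-rec)
open import Data.Nat.Primality
  using (prime⇒nonZero; prime⇒nonTrivial; prime⇒irreducible; ¬prime[1])
open import Data.Nat.Properties hiding (0≢1+n; suc-injective)
open import Data.Product using (∃; ∃₂; _,_; proj₁; proj₂)
open import Data.Sum using (inj₁; inj₂)
open import Function using (_∘_)
open import Relation.Binary.PropositionalEquality
open import Relation.Nullary using (yes; no; contradiction)

nC0≡1 : ∀ n → n C 0 ≡ 1
nC0≡1 n = trans (nCk≡nC[n∸k] {0} {n} z≤n) (nCn≡1 n)

absorption-pred : ∀ n .{{_ : NonZero n}} k → suc k * (n C suc k) ≡ n * (pred n C k)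
absorption-pred (suc n) k = absorption n k

pascal-pred : ∀ n .{{_ : NonZero n}} k → pred n C k + pred n C suc k ≡ n C suc k
pascal-pred (suc n) k = nCk+nC[k+1]≡[n+1]C[k+1] n k

-- A common divisor of `a * b` and `c` is coprime to `a`, as a divisor of `c`, so it divides `b`.
coprime-* : ∀ {a b c} → Coprime a c → Coprime b c → Coprime (a * b) c
coprime-* {a} a⊥c b⊥c {d} (d∣ab , d∣c) = b⊥c (coprime-divisor d⊥a d∣ab , d∣c)
  where
  d⊥a : Coprime d a
  d⊥a (e∣d , e∣a) = a⊥c (e∣a , ∣-trans e∣d d∣c)

-- Columns of Pascal's triangle modulo `m`, and the lower bound.

module _ (m : ℕ) .{{_ : NonZero m}} where

  +-cong-% : ∀ {a a′ b b′} → a % m ≡ a′ % m → b % m ≡ b′ % m → (a + b) % m ≡ (a′ + b′) % m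
  +-cong-% {a} {a′} {b} {b′} a≡ b≡ = begin
    (a + b) % m            ≡⟨ %-distribˡ-+ a b m ⟩
    (a % m + b % m) % m    ≡⟨ cong₂ (λ x y → (x + y) % m) a≡ b≡ ⟩
    (a′ % m + b′ % m) % m  ≡⟨ %-distribˡ-+ a′ b′ m ⟨
    (a′ + b′) % m          ∎
    where open ≡-Reasoning

  *-congˡ-% : ∀ c {b b′} → b % m ≡ b′ % m → (c * b) % m ≡ (c * b′) % m
  *-congˡ-% zero    b≡ = refl
  *-congˡ-% (suc c) b≡ = +-cong-% b≡ (*-congˡ-% c b≡)

  -- `pred m * b` serves as the negative of `b`: adding it to `a + b` gives `a + m * b`, which is
  -- `a` modulo `m`.
  +-cancelʳ-% : ∀ {a a′ b b′} → (a + b) % m ≡ (a′ + b′) % m → b % m ≡ b′ % m → a % m ≡ a′ % m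
  +-cancelʳ-% {a} {a′} {b} {b′} s≡ b≡ = begin
    a % m                       ≡⟨ add a b ⟨
    (a + b + pred m * b) % m    ≡⟨ +-cong-% s≡ (*-congˡ-% (pred m) b≡) ⟩
    (a′ + b′ + pred m * b′) % m ≡⟨ add a′ b′ ⟩
    a′ % m                      ∎
    where
    open ≡-Reasoning
    add : ∀ x y → (x + y + pred m * y) % m ≡ x % m
    add x y = begin
      (x + y + pred m * y) % m    ≡⟨ cong (_% m) (+-assoc x y (pred m * y)) ⟩
      (x + suc (pred m) * y) % m  ≡⟨ cong (λ z → (x + z * y) % m) (suc-pred m) ⟩
      (x + m * y) % m             ≡⟨ cong (λ z → (x + z) % m) (*-comm m y) ⟩
      (x + y * m) % m             ≡⟨ [m+kn]%n≡m%n x y m ⟩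
      x % m                       ∎

  IsPeriodOfColumn : ℕ → ℕ → Set
  IsPeriodOfColumn T k = ∀ n → ((n + T) C k) % m ≡ (n C k) % m

  -- Induction on `n`: the divisibility is the case `n = 0`, and Pascal's rule gives the step.
  column-suc : ∀ {T k} → IsPeriodOfColumn T k → m ∣ T C suc k → IsPeriodOfColumn T (suc k)
  column-suc {T} {k} per m∣ zero    = trans (n∣m⇒m%n≡0 _ m m∣) (sym (n∣m⇒m%n≡0 0 m (m ∣0)))
  column-suc {T} {k} per m∣ (suc n) = begin
    (suc (n + T) C suc k) % m              ≡⟨ cong (_% m) (nCk+nC[k+1]≡[n+1]C[k+1] (n + T) k) ⟨
    ((n + T) C k + (n + T) C suc k) % m    ≡⟨ +-cong-% (per n) (column-suc {T} per m∣ n) ⟩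
    (n C k + n C suc k) % m                ≡⟨ cong (_% m) (nCk+nC[k+1]≡[n+1]C[k+1] n k) ⟩
    (suc n C suc k) % m                    ∎
    where open ≡-Reasoning

  -- By Pascal's rule, column `k` is the difference between column `suc k` shifted by one and column
  -- `suc k` itself.
  column-pred : ∀ {T k} → IsPeriodOfColumn T (suc k) → IsPeriodOfColumn T k
  column-pred {T} {k} per n = +-cancelʳ-% s≡ (per n)
    where
    open ≡-Reasoning
    s≡ : ((n + T) C k + (n + T) C suc k) % m ≡ (n C k + n C suc k) % m
    s≡ = begin
      ((n + T) C k + (n + T) C suc k) % m  ≡⟨ cong (_% m) (nCk+nC[k+1]≡[n+1]C[k+1] (n + T) k) ⟩
      (suc (n + T) C suc k) % m            ≡⟨ per (suc n) ⟩
      (suc n C suc k) % m                  ≡⟨ cong (_% m) (nCk+nC[k+1]≡[n+1]C[k+1] n k) ⟨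
      (n C k + n C suc k) % m              ∎

  ∣C⇒column : ∀ {T} → (∀ k → suc k ≤ m → m ∣ T C suc k) → ∀ k → k ≤ m → IsPeriodOfColumn T k
  ∣C⇒column     m∣ zero    _   n = refl
  ∣C⇒column {T} m∣ (suc k) k<m = column-suc {T} (∣C⇒column {T} m∣ k (<⇒≤ k<m)) (m∣ k k<m)

  -- IsPeriod only constrains positive n; the value at n = 0 is transported along
  -- the period period₀, which is valid from 0 on.
  isPeriod⇒column : ∀ {T} → IsPeriod m T → IsPeriodOfColumn T m
  isPeriod⇒column {T} (_ , per) zero = begin
    (T C m) % m               ≡⟨ period₀-≡ m T m ≤-refl ⟨
    ((T + period₀ m) C m) % m ≡⟨ cong (λ x → (x C m) % m) (+-comm T (period₀ m)) ⟩
    ((period₀ m + T) C m) % m ≡⟨ per (period₀ m) (period₀>0 m) ⟩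
    (period₀ m C m) % m       ≡⟨ period₀-≡ m 0 m ≤-refl ⟩
    (0 C m) % m               ∎
    where open ≡-Reasoning
  isPeriod⇒column (_ , per) (suc n) = per (suc n) z<s

  columns-below : ∀ {T} d {k} → IsPeriodOfColumn T (d + k) → IsPeriodOfColumn T k
  columns-below     zero    per = per
  columns-below {T} (suc d) per = columns-below {T} d (column-pred {T} per)

  column⇒∣C : ∀ {T} → IsPeriodOfColumn T m → ∀ k → suc k ≤ m → m ∣ T C suc k
  -- At `n = 0` the period compares `T C suc k` with `0 C suc k`, which is 0.
  column⇒∣C {T} per k k<m = m%n≡0⇒n∣m _ m (trans (below 0) (n∣m⇒m%n≡0 0 m (m ∣0)))
    where
    below : IsPeriodOfColumn T (suc k)
    below = columns-below {T} (m ∸ suc k) (subst (IsPeriodOfColumn T) (sym (m∸n+n≡m k<m)) per)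

  -- A common divisor of `m` and an entry of row `pred T` also divides the entry to its left, by
  -- Pascal's rule; the descent ends at column 0, where the entry is 1.
  coprime-C-pred : ∀ {T} .{{_ : NonZero T}} → (∀ k → suc k ≤ m → m ∣ T C suc k) →
                   ∀ k → k ≤ m → Coprime m (pred T C k)
  coprime-C-pred {T} m∣ zero    _   {d} (_ , d∣C) = ∣1⇒≡1 (subst (d ∣_) (nC0≡1 (pred T)) d∣C)
  coprime-C-pred {T} m∣ (suc k) k<m {d} (d∣m , d∣C) =
    coprime-C-pred m∣ k (<⇒≤ k<m) (d∣m , ∣m+n∣m⇒∣n d∣sum d∣C)
    where
    d∣sum : d ∣ pred T C suc k + pred T C k
    d∣sum = subst (d ∣_) (trans (sym (pascal-pred T k)) (+-comm (pred T C k) _))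
              (∣-trans d∣m (m∣ k k<m))

  ∣C⇒m²∣ : ∀ {T} .{{_ : NonZero T}} → (∀ k → suc k ≤ m → m ∣ T C suc k) → m * m ∣ T
  ∣C⇒m²∣ {T} m∣ = coprime-divisor (coprime-* m-coprime m-coprime) m²∣c*T
    where
    c = pred T C pred m

    m-coprime : Coprime m c
    m-coprime = coprime-C-pred m∣ (pred m) (pred[n]≤n {m})

    m²∣c*T : m * m ∣ c * T
    m²∣c*T = subst (m * m ∣_) eq (*-monoʳ-∣ m (m∣ (pred m) (≤-reflexive (suc-pred m))))
      where
      open ≡-Reasoning
      eq : m * (T C suc (pred m)) ≡ c * T
      eq = begin
        m * (T C suc (pred m))            ≡⟨ cong (_* (T C suc (pred m))) (suc-pred m) ⟨
        suc (pred m) * (T C suc (pred m)) ≡⟨ absorption-pred T (pred m) ⟩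
        T * c                             ≡⟨ *-comm T c ⟩
        c * T                             ∎

  isPeriod⇒m²≤ : ∀ {T} → IsPeriod m T → m ^ 2 ≤ T
  isPeriod⇒m²≤ {T} per@(T>0 , _) =
    -- `m ^ 2` unfolds to `m * (m * 1)`.
    subst (_≤ T) (cong (m *_) (sym (*-identityʳ m)))
      (∣⇒≤ (∣C⇒m²∣ (column⇒∣C {T} (isPeriod⇒column per))))
    where instance
    T≢0 : NonZero T
    T≢0 = >-nonZero T>0

-- Finite products and coprimality.

∏-nonZero : ∀ {w} (f : Fin w → ℕ) → (∀ i → NonZero (f i)) → NonZero (∏ f)
∏-nonZero {zero}  f f≢0 = _
∏-nonZero {suc w} f f≢0 = m*n≢0 _ _ {{f≢0 zero}} {{∏-nonZero (f ∘ suc) (f≢0 ∘ suc)}}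

∏-≤-^ : ∀ {w} (f : Fin w → ℕ) {c} → (∀ i → f i ≤ c) → ∏ f ≤ c ^ w
∏-≤-^ {zero}  f f≤c = ≤-refl
∏-≤-^ {suc w} f f≤c = *-mono-≤ (f≤c zero) (∏-≤-^ (f ∘ suc) (f≤c ∘ suc))

∣∏ : ∀ {w} (f : Fin w → ℕ) i → f i ∣ ∏ f
∣∏ f zero    = m∣m*n _
∣∏ f (suc i) = ∣n⇒∣m*n (f zero) (∣∏ (f ∘ suc) i)

coprime-^ : ∀ {a c} n → Coprime a c → Coprime (a ^ n) c
coprime-^ {c = c} zero    a⊥c = 1-coprimeTo c
coprime-^         (suc n) a⊥c = coprime-* a⊥c (coprime-^ n a⊥c)

coprime-∏ : ∀ {w} (f : Fin w → ℕ) {c} → (∀ i → Coprime (f i) c) → Coprime (∏ f) c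
coprime-∏ {zero}  f {c} f⊥c = 1-coprimeTo c
coprime-∏ {suc w} f     f⊥c = coprime-* (f⊥c zero) (coprime-∏ (f ∘ suc) (f⊥c ∘ suc))

pairwiseCoprime-∏∣ : ∀ {w} (f : Fin w → ℕ) {n} → (∀ i j → i ≢ j → Coprime (f i) (f j)) →
                     (∀ i → f i ∣ n) → ∏ f ∣ n
pairwiseCoprime-∏∣ {zero}  f {n} f⊥f f∣n = 1∣ n
pairwiseCoprime-∏∣ {suc w} f {n} f⊥f f∣n
  -- Here `n = q * R`; the first factor is coprime to `R`, hence divides `q`.
  with divides q refl ← pairwiseCoprime-∏∣ (f ∘ suc) (λ i j i≢j → f⊥f (suc i) (suc j) (i≢j ∘ suc-injective)) (f∣n ∘ suc)
  = *-monoˡ-∣ R (coprime-divisor f₀⊥R (subst (f zero ∣_) (*-comm q R) (f∣n zero)))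
  where
  R = ∏ (f ∘ suc)
  f₀⊥R : Coprime (f zero) R
  f₀⊥R = coprime-sym (coprime-∏ (f ∘ suc) λ i → f⊥f (suc i) zero (0≢1+n ∘ sym))

-- Primes and prime powers.

prime∤⇒coprime : ∀ {p n} → Prime p → p ∤ n → Coprime p n
prime∤⇒coprime pp p∤n (d∣p , d∣n) with prime⇒irreducible pp d∣p
... | inj₁ d≡1  = d≡1
... | inj₂ refl = contradiction d∣n p∤n

distinctPrimes-coprime : ∀ {p q} → Prime p → Prime q → p ≢ q → Coprime p q
distinctPrimes-coprime {p} {q} pp pq p≢q = prime∤⇒coprime pp p∤q
  where
  p∤q : p ∤ q
  p∤q p∣q with prime⇒irreducible pq p∣q
  ... | inj₁ refl = ¬prime[1] pp
  ... | inj₂ p≡q  = p≢q p≡q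

prime-part : ∀ {p} → Prime p → ∀ k → .{{NonZero k}} → ∃₂ λ a r → k ≡ p ^ a * r × Coprime p r
prime-part {p} pp = <-rec _ step
  where
  step : ∀ k → (∀ {j} → j < k → .{{NonZero j}} → ∃₂ λ a r → j ≡ p ^ a * r × Coprime p r) →
         .{{NonZero k}} → ∃₂ λ a r → k ≡ p ^ a * r × Coprime p r
  step k rec with p ∣? k
  ... | no  p∤k = 0 , k , sym (*-identityˡ k) , prime∤⇒coprime pp p∤k
  ... | yes p∣k
    with a , r , q≡ , p⊥r ← rec (quotient-< p∣k {{prime⇒nonTrivial pp}}) {{quotient≢0 p∣k}}
    = suc a , r ,
      trans (m∣n⇒n≡m*quotient p∣k) (trans (cong (p *_) q≡) (sym (*-assoc p (p ^ a) r))) , p⊥r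

^-monoʳ-∣ : ∀ p a e → a ≤ e → p ^ a ∣ p ^ e
^-monoʳ-∣ p a e a≤e =
  subst (p ^ a ∣_) (trans (sym (^-distribˡ-+-* p a (e ∸ a))) (cong (p ^_) (m+[n∸m]≡n a≤e)))
    (m∣m*n (p ^ (e ∸ a)))

floorLog : ∀ {p} → 1 < p → ∀ m .{{_ : NonZero m}} → ∃ λ e → p ^ e ≤ m × m < p ^ suc e
floorLog {p} 1<p (suc zero)      = 0 , ≤-refl , subst (1 <_) (sym (*-identityʳ p)) 1<p
floorLog {p} 1<p (suc m@(suc _)) with floorLog 1<p m
... | e , ≤m , m< with p ^ suc e ≤? suc m
-- The bound `m < p ^ suc e` reads `suc m ≤ p ^ suc e`, so the exponent grows by at most one.
...   | yes p^≤ = suc e , p^≤ , ≤-<-trans m< (^-monoʳ-< p 1<p (n<1+n (suc e)))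
...   | no  p^≰ = e , m≤n⇒m≤1+n ≤m , ≰⇒> p^≰

-- Recasts maximality of the exponent as divisibility, the form in which `primePower∣C` uses it.
largestPower : ∀ {p} → 1 < p → ∀ m .{{_ : NonZero m}} →
               ∃ λ e → p ^ e ≤ m × (∀ a → p ^ a ≤ m → p ^ a ∣ p ^ e)
largestPower {p} 1<p m with floorLog 1<p m
... | e , ≤m , m< = e , ≤m , λ a p^a≤m → ^-monoʳ-∣ p a e (≮⇒≥ λ e<a →
  <⇒≱ m< (≤-trans (^-monoʳ-≤ p {{>-nonZero (<⇒≤ 1<p)}} e<a) p^a≤m))

-- Write `suc k = p ^ a * r` with `r` coprime to `p`. Since `p ^ a ≤ m`, `p ^ a` divides `q`, so
-- `p ^ a * p ^ b` divides `T` and hence `suc k * (T C suc k)`; then `p ^ a` and `r` cancel.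
primePower∣C : ∀ {p b q m T} → Prime p → (∀ a → p ^ a ≤ m → p ^ a ∣ q) →
               p ^ b * q ∣ T → .{{_ : NonZero T}} → ∀ k → suc k ≤ m → p ^ b ∣ T C suc k
primePower∣C {p} {b} {q} {m} {T} pp largest p^bq∣T k k<m
  with a , r , k≡ , p⊥r ← prime-part pp (suc k)
  = coprime-divisor (coprime-^ b p⊥r) (*-cancelˡ-∣ (p ^ a) p^ap^b∣)
  where
  instance
    p≢0 : NonZero p
    p≢0 = prime⇒nonZero pp
    p^a≢0 : NonZero (p ^ a)
    p^a≢0 = m^n≢0 p a
  p^a≤m : p ^ a ≤ m
  p^a≤m = ≤-trans (∣⇒≤ (subst (p ^ a ∣_) (sym k≡) (m∣m*n r))) k<m
  open ≡-Reasoning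
  eq : T * (pred T C k) ≡ p ^ a * (r * (T C suc k))
  eq = begin
    T * (pred T C k)          ≡⟨ absorption-pred T k ⟨
    suc k * (T C suc k)       ≡⟨ cong (_* (T C suc k)) k≡ ⟩
    p ^ a * r * (T C suc k)   ≡⟨ *-assoc (p ^ a) r _ ⟩
    p ^ a * (r * (T C suc k)) ∎
  p^ap^b∣ : p ^ a * p ^ b ∣ p ^ a * (r * (T C suc k))
  p^ap^b∣ = subst₂ _∣_ (*-comm (p ^ b) (p ^ a)) eq
    (∣m⇒∣m*n _ (∣-trans (*-monoʳ-∣ (p ^ b) (largest a p^a≤m)) p^bq∣T))

corollary2p4 : (m : ℕ) .{{_ : NonZero m}} →
    (w : ℕ) (p b : Fin w → ℕ) →
    (∀ i → Prime (p i)) →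
    Injective _≡_ _≡_ p →
    (∀ i → 1 ≤ b i) →
    m ≡ ∏ (λ i → p i ^ b i) →
    (m ^ 2 ≤ ℓ m) × (ℓ m ≤ m ^ (w + 1))
corollary2p4 m w p b p-prime p-inj b≥1 m≡∏ =
  isPeriod⇒m²≤ m (proj₁ (ℓ-isLeastPeriod m)) ,
  ≤-trans (proj₂ (ℓ-isLeastPeriod m) T T-isPeriod) T≤
  where
  log : ∀ i → ∃ λ e → p i ^ e ≤ m × (∀ a → p i ^ a ≤ m → p i ^ a ∣ p i ^ e)
  log i = largestPower (nonTrivial⇒n>1 (p i) {{prime⇒nonTrivial (p-prime i)}}) m

  q : Fin w → ℕ
  q i = p i ^ proj₁ (log i)

  T : ℕ
  T = m * ∏ q

  instance
    ∏q≢0 : NonZero (∏ q)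
    ∏q≢0 = ∏-nonZero q λ i → m^n≢0 (p i) (proj₁ (log i)) {{prime⇒nonZero (p-prime i)}}

    T≢0 : NonZero T
    T≢0 = m*n≢0 m (∏ q)

  p^bq∣T : ∀ i → p i ^ b i * q i ∣ T
  p^bq∣T i = *-pres-∣ (subst (p i ^ b i ∣_) (sym m≡∏) (∣∏ (λ j → p j ^ b j) i)) (∣∏ q i)

  p^b-coprime : ∀ i j → i ≢ j → Coprime (p i ^ b i) (p j ^ b j)
  -- `coprime-^` raises only the left argument, so symmetry is applied around its second use.
  p^b-coprime i j i≢j = coprime-^ (b i) (coprime-sym (coprime-^ (b j) (coprime-sym
    (distinctPrimes-coprime (p-prime i) (p-prime j) (i≢j ∘ p-inj)))))

  -- The prime-power factors of `m` are pairwise coprime, so each can be treated separately.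
  m∣C : ∀ k → suc k ≤ m → m ∣ T C suc k
  m∣C k k<m = subst (_∣ T C suc k) (sym m≡∏)
    (pairwiseCoprime-∏∣ (λ i → p i ^ b i) p^b-coprime
      λ i → primePower∣C {b = b i} (p-prime i) (proj₂ (proj₂ (log i))) (p^bq∣T i) k k<m)

  T-isPeriod : IsPeriod m T
  T-isPeriod = >-nonZero⁻¹ T , λ n _ → ∣C⇒column m {T} m∣C m ≤-refl n

  T≤ : T ≤ m ^ (w + 1)
  -- The factor `m` together with the `w` factors `q i` gives exponent `1 + w`.
  T≤ = subst (λ e → T ≤ m ^ e) (+-comm 1 w) (*-monoʳ-≤ m (∏-≤-^ q (proj₁ ∘ proj₂ ∘ log)))
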